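{- Let $n\geq 5$ and let $g$ be a positive integer with $g\leq 2^{[\frac{n+1}{2}]}$. Then $$c\lambda_{g+1}(FQ_n)=(n+1)g-\frac{ex_g}{2},$$ where $ex_g=\max\{2|E(FQ_n[X])| : X\subseteq V(FQ_n),\ |X|=g\}$.
   Context: The $n$-dimensional hypercube $Q_n$ has as vertices all binary strings of length $n$, two vertices being adjacent iff they differ in exactly one coordinate. The folded hypercube $FQ_n$ is obtained from $Q_n$ by adding the perfect matching $\{u\bar u : u\in V(Q_n)\}$, where $\bar u$ is the bitwise complement of $u$; it is $(n+1)$-regular. For a non-complete graph $G$ and positive integer $k$, a $k$-component edge cut is a set of edges whose deletion leaves a graph with at least $k$ components, and the $k$-component edge connectivity $c\lambda_k(G)$ is the minimum size of a $k$-component edge cut. $FQ_n[X]$ denotes the subgraph induced by $X$. $[x]$ denotes the integer part of $x$. -}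

module Defs where

open import Data.Bool using (Bool; true; false; not; _∧_; _∨_; T)
open import Data.Nat using (ℕ; zero; suc; _+_; _*_; _≡ᵇ_; _≤_; ⌊_/2⌋)
open import Data.List using (List; []; _∷_; _++_; map; concatMap; length)
open import Data.Vec using (Vec; []; _∷_; lookup)
open import Data.Fin using (Fin)
open import Data.Product using (Σ; _×_; _,_; ∃)
open import Relation.Binary.PropositionalEquality using (_≡_; _≢_)
open import Relation.Nullary using (¬_)

V : ℕ → Set
V n = Vec Bool n

allV : (n : ℕ) → List (V n)
allV zero    = [] ∷ []
allV (suc n) = map (false ∷_) (allV n) ++ map (true ∷_) (allV n)

comp : ∀ {n} → V n → V n
comp []       = []
comp (b ∷ u) = not b ∷ comp u

ham : ∀ {n} → V n → V n → ℕ
ham []      []      = 0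
ham (true  ∷ u) (true  ∷ v) = ham u v
ham (false ∷ u) (false ∷ v) = ham u v
ham (_     ∷ u) (_     ∷ v) = suc (ham u v)

adjFQ : ∀ {n} → V n → V n → Bool
adjFQ u v = (ham u v ≡ᵇ 1) ∨ (ham u (comp v) ≡ᵇ 0)

countB : ∀ {A : Set} → (A → Bool) → List A → ℕ
countB p []       = 0
countB p (x ∷ xs) with p x
... | true  = suc (countB p xs)
... | false = countB p xs

allPairs : (n : ℕ) → List (V n × V n)
allPairs n = concatMap (λ u → map (λ v → (u , v)) (allV n)) (allV n)

-- Edge sets of FQ_n.
-- An edge set is given by a boolean function F on ordered pairs; the
-- (unordered) edge uv of FQ_n belongs to the set iff F u v ∨ F v u.
-- Values of F on non-adjacent pairs are irrelevant.
EdgeSet : ℕ → Set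
EdgeSet n = V n → V n → Bool

inF : ∀ {n} → EdgeSet n → V n → V n → Bool
inF F u v = adjFQ u v ∧ (F u v ∨ F v u)

-- |F| : number of (unordered) edges of FQ_n in F
-- (the count of ordered pairs is exactly twice this number).
edgeCount : ∀ {n} → EdgeSet n → ℕ
edgeCount {n} F = ⌊ countB (λ { (u , v) → inF F u v }) (allPairs n) /2⌋

adjDel : ∀ {n} → EdgeSet n → V n → V n → Bool
adjDel F u v = adjFQ u v ∧ not (F u v ∨ F v u)

data Reach {n : ℕ} (F : EdgeSet n) : V n → V n → Set where
  here : ∀ {u} → Reach F u u
  step : ∀ {u v w} → T (adjDel F u v) → Reach F v w → Reach F u w

AtLeastComponents : ∀ {n} → EdgeSet n → ℕ → Set
AtLeastComponents {n} F k =
  Σ (Vec (V n) k) λ vs → ∀ (i j : Fin k) → i ≢ j → ¬ Reach F (lookup vs i) (lookup vs j)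

IsKCompEdgeCut : (n k : ℕ) → EdgeSet n → Set
IsKCompEdgeCut n k F = AtLeastComponents F k

IsCλ : (n k c : ℕ) → Set
IsCλ n k c =
  (Σ (EdgeSet n) λ F → IsKCompEdgeCut n k F × edgeCount F ≡ c)
  × (∀ (F : EdgeSet n) → IsKCompEdgeCut n k F → c ≤ edgeCount F)

VSet : ℕ → Set
VSet n = V n → Bool

card : ∀ {n} → VSet n → ℕ
card {n} X = countB X (allV n)

twiceEdgesInduced : ∀ {n} → VSet n → ℕ
twiceEdgesInduced {n} X =
  countB (λ { (u , v) → X u ∧ X v ∧ adjFQ u v }) (allPairs n)

IsExG : (n g e : ℕ) → Set
IsExG n g e =
  (Σ (VSet n) λ X → card X ≡ g × twiceEdgesInduced X ≡ e)
  × (∀ (X : VSet n) → card X ≡ g → twiceEdgesInduced X ≤ e)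

{-# OPTIONS --safe #-}
module Submission where

-- FQₙ is connected and arc-transitive. So if A is a nonempty proper set of vertices and B spans
-- an edge, an automorphism moves B so that it meets A without being contained in A. As the number
-- of induced edges is supermodular, passing from (A , B) to (A ∪ B , A ∩ B) loses no edges and
-- makes the second set smaller; iterating, one finds a set of |A| + |B| − 1 vertices spanning at
-- least as many edges as A and B together. Merging all g + 1 parts left by a cut in this way
-- yields a set C of 2ⁿ − g vertices spanning at least as many edges as survive the cut, and
-- counting edges at the g vertices outside C gives the lower bound. Isolating the vertices of
-- an optimal g-set attains it.

open import Defs
open import Data.Nat using (ℕ; zero; suc; _+_; _*_; _∸_; _≤_; _<_; _^_; ⌊_/2⌋; _≡ᵇ_; z≤n; s≤s; s≤s⁻¹; _≤?_)
open import Data.Nat.ListAction using (sum)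
open import Data.Nat.ListAction.Properties using (sum-++)
open import Data.Nat.Properties
open import Data.Nat.Tactic.RingSolver using (solve-∀)
open import Algebra.Properties.CommutativeSemigroup +-commutativeSemigroup using (interchange)
open import Data.Bool using (Bool; true; false; not; _∧_; _∨_; _xor_; T; if_then_else_)
open import Data.Bool.Properties using (not-involutive; ∨-comm; ∨-zeroʳ; T-≡; ¬-not)
open import Data.Fin using (Fin; zero; suc)
open import Data.List using (List; []; _∷_; map; concatMap)
open import Data.List.Properties using (map-++; map-∘)
open import Data.Product using (Σ; _×_; _,_; ∃; ∃₂; proj₁; proj₂)
open import Data.Sum using (_⊎_; inj₁; inj₂; swap)
open import Data.Vec using (Vec; []; _∷_; lookup; updateAt; zipWith)
open import Data.Vec.Properties using (lookup∘updateAt)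
open import Function using (_∘_; Equivalence)
open import Relation.Binary.PropositionalEquality
open import Relation.Nullary using (¬_; contradiction; yes; no)
open import Relation.Nullary.Decidable using (¬¬-excluded-middle; decidable-stable)

private variable n : ℕ

-- Finite sums over the vertices of the cube.

⟦_⟧ : Bool → ℕ
⟦ true ⟧  = 1
⟦ false ⟧ = 0

-- Recursion on the dimension splits a sum definitionally over the two half-cubes, so the basic laws
-- follow by induction on `n`.
∑ : (V n → ℕ) → ℕ
∑ {zero}  f = f []
∑ {suc n} f = ∑ (f ∘ (false ∷_)) + ∑ (f ∘ (true ∷_))

∑-cong : {f g : V n → ℕ} → (∀ v → f v ≡ g v) → ∑ f ≡ ∑ g
∑-cong {zero}  e = e []
∑-cong {suc n} e = cong₂ _+_ (∑-cong (e ∘ (false ∷_))) (∑-cong (e ∘ (true ∷_)))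

∑-mono : {f g : V n → ℕ} → (∀ v → f v ≤ g v) → ∑ f ≤ ∑ g
∑-mono {zero}  e = e []
∑-mono {suc n} e = +-mono-≤ (∑-mono (e ∘ (false ∷_))) (∑-mono (e ∘ (true ∷_)))

∑-+ : (f g : V n → ℕ) → ∑ (λ v → f v + g v) ≡ ∑ f + ∑ g
∑-+ {zero}  f g = refl
∑-+ {suc n} f g =
  trans (cong₂ _+_ (∑-+ (f ∘ (false ∷_)) (g ∘ (false ∷_))) (∑-+ (f ∘ (true ∷_)) (g ∘ (true ∷_))))
        (interchange (∑ (f ∘ (false ∷_))) (∑ (g ∘ (false ∷_))) (∑ (f ∘ (true ∷_))) (∑ (g ∘ (true ∷_))))

∑-*ʳ : (f : V n → ℕ) (c : ℕ) → ∑ (λ v → f v * c) ≡ ∑ f * c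
∑-*ʳ {zero}  f c = refl
∑-*ʳ {suc n} f c =
  trans (cong₂ _+_ (∑-*ʳ (f ∘ (false ∷_)) c) (∑-*ʳ (f ∘ (true ∷_)) c))
        (sym (*-distribʳ-+ c (∑ (f ∘ (false ∷_))) (∑ (f ∘ (true ∷_)))))

∑-zero : ∑ {n} (λ _ → 0) ≡ 0
∑-zero {n} = trans (∑-*ʳ {n} (λ _ → 0) 0) (*-zeroʳ (∑ {n} (λ _ → 0)))

∑-one : ∀ n → ∑ {n} (λ _ → 1) ≡ 2 ^ n
∑-one zero    = refl
∑-one (suc n) rewrite ∑-one n = cong (2 ^ n +_) (sym (+-identityʳ (2 ^ n)))

∑-swap : ∀ {m} (f : V m → V n → ℕ) → ∑ (λ u → ∑ (f u)) ≡ ∑ (λ v → ∑ (λ u → f u v))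
∑-swap {m = zero}  f = refl
∑-swap {m = suc m} f =
  trans (cong₂ _+_ (∑-swap (f ∘ (false ∷_))) (∑-swap (f ∘ (true ∷_))))
        (sym (∑-+ (λ v → ∑ (λ u → f (false ∷ u) v)) (λ v → ∑ (λ u → f (true ∷ u) v))))

-- Equality through Hamming distance, reindexing, parity and search.

ham-refl : (u : V n) → ham u u ≡ 0
ham-refl []          = refl
ham-refl (false ∷ u) = ham-refl u
ham-refl (true  ∷ u) = ham-refl u

ham-sym : (u v : V n) → ham u v ≡ ham v u
ham-sym []          []          = refl
ham-sym (false ∷ u) (false ∷ v) = ham-sym u v
ham-sym (false ∷ u) (true  ∷ v) = cong suc (ham-sym u v)
ham-sym (true  ∷ u) (false ∷ v) = cong suc (ham-sym u v)
ham-sym (true  ∷ u) (true  ∷ v) = ham-sym u v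

ham≡0⇒≡ : (u v : V n) → ham u v ≡ 0 → u ≡ v
ham≡0⇒≡ []          []          _ = refl
ham≡0⇒≡ (false ∷ u) (false ∷ v) e = cong (false ∷_) (ham≡0⇒≡ u v e)
ham≡0⇒≡ (true  ∷ u) (true  ∷ v) e = cong (true ∷_) (ham≡0⇒≡ u v e)

-- Defined through `ham` so that the second disjunct of `adjFQ u v` is literally `u == comp v`.
_==_ : V n → V n → Bool
u == v = ham u v ≡ᵇ 0

==⇒≡ : (u v : V n) → (u == v) ≡ true → u ≡ v
==⇒≡ u v e = ham≡0⇒≡ u v (≡ᵇ⇒≡ _ 0 (Equivalence.from T-≡ e))

==-refl : (u : V n) → (u == u) ≡ true
==-refl u rewrite ham-refl u = refl

⇔⇒≡ : {a b : Bool} → (a ≡ true → b ≡ true) → (b ≡ true → a ≡ true) → a ≡ b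
⇔⇒≡ {false} {false} _ _ = refl
⇔⇒≡ {false} {true}  _ q = q refl
⇔⇒≡ {true}  {b}     p _ = sym (p refl)

∑-== : (u : V n) (f : V n → ℕ) → ∑ (λ v → ⟦ u == v ⟧ * f v) ≡ f u
∑-== []          f = +-identityʳ (f [])
∑-== {suc n} (false ∷ u) f =
  trans (cong₂ _+_ (∑-== u (f ∘ (false ∷_))) (∑-zero {n})) (+-identityʳ _)
∑-== {suc n} (true  ∷ u) f = cong₂ _+_ (∑-zero {n}) (∑-== u (f ∘ (true ∷_)))

∑-singleton : (u : V n) → ∑ (λ v → ⟦ u == v ⟧) ≡ 1
∑-singleton u = trans (∑-cong (λ v → sym (*-identityʳ ⟦ u == v ⟧))) (∑-== u (λ _ → 1))

-- Expand `f (φ u)` against the indicator of the point `φ u` and exchange the two sums. For an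
-- involution, `φ u == v` and `φ v == u` are the same condition, so the inner sum collapses again.
∑-reindex : (φ : V n → V n) → (∀ v → φ (φ v) ≡ v) → (f : V n → ℕ) → ∑ (f ∘ φ) ≡ ∑ f
∑-reindex φ inv f = begin
  ∑ (λ u → f (φ u))                         ≡⟨ ∑-cong (λ u → sym (∑-== (φ u) f)) ⟩
  ∑ (λ u → ∑ (λ v → ⟦ φ u == v ⟧ * f v))    ≡⟨ ∑-swap (λ u v → ⟦ φ u == v ⟧ * f v) ⟩
  ∑ (λ v → ∑ (λ u → ⟦ φ u == v ⟧ * f v))    ≡⟨ ∑-cong (λ v → ∑-cong (λ u → cong (λ b → ⟦ b ⟧ * f v) (transpose u v))) ⟩
  ∑ (λ v → ∑ (λ u → ⟦ φ v == u ⟧ * f v))    ≡⟨ ∑-cong (λ v → ∑-== (φ v) (λ _ → f v)) ⟩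
  ∑ f ∎
  where
  open ≡-Reasoning
  half : ∀ u v → (φ u == v) ≡ true → (φ v == u) ≡ true
  half u v e with refl ← ==⇒≡ (φ u) v e = subst (λ w → (w == u) ≡ true) (sym (inv u)) (==-refl u)
  transpose : ∀ u v → (φ u == v) ≡ (φ v == u)
  transpose u v = ⇔⇒≡ (half u v) (half v u)

-- Splitting both arguments by their first coordinate gives four blocks. The diagonal blocks are
-- even by induction, and symmetry makes the two off-diagonal blocks equal. Irreflexivity settles
-- dimension zero.
sum-symmetric-even : (R : V n → V n → Bool) → (∀ u v → R u v ≡ R v u) → (∀ u → R u u ≡ false) →
  ∃ λ k → ∑ (λ u → ∑ (λ v → ⟦ R u v ⟧)) ≡ k + k
sum-symmetric-even {zero} R _ irr rewrite irr [] = 0 , refl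
sum-symmetric-even {suc n} R sy irr
  with k , p ← sum-symmetric-even (λ u v → R (false ∷ u) (false ∷ v)) (λ u v → sy _ _) (λ u → irr _)
     | l , q ← sum-symmetric-even (λ u v → R (true ∷ u) (true ∷ v)) (λ u v → sy _ _) (λ u → irr _)
  = k + m + l , (begin
    ∑ (λ u → row₀₀ u + row₀₁ u) + ∑ (λ u → row₁₀ u + row₁₁ u) ≡⟨ cong₂ _+_ (∑-+ row₀₀ row₀₁) (∑-+ row₁₀ row₁₁) ⟩
    (∑ row₀₀ + m) + (∑ row₁₀ + ∑ row₁₁)                       ≡⟨ cong₂ (λ a b → (a + m) + (∑ row₁₀ + b)) p q ⟩
    (k + k + m) + (∑ row₁₀ + (l + l))                         ≡⟨ cong (λ a → (k + k + m) + (a + (l + l))) transposed ⟩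
    (k + k + m) + (m + (l + l))                               ≡⟨ rearrange k m l ⟩
    k + m + l + (k + m + l) ∎)
  where
  open ≡-Reasoning
  row₀₀ row₀₁ row₁₀ row₁₁ : V n → ℕ
  row₀₀ u = ∑ (λ v → ⟦ R (false ∷ u) (false ∷ v) ⟧)
  row₀₁ u = ∑ (λ v → ⟦ R (false ∷ u) (true  ∷ v) ⟧)
  row₁₀ u = ∑ (λ v → ⟦ R (true  ∷ u) (false ∷ v) ⟧)
  row₁₁ u = ∑ (λ v → ⟦ R (true  ∷ u) (true  ∷ v) ⟧)
  m = ∑ row₀₁
  transposed : ∑ row₁₀ ≡ m
  transposed = trans (∑-cong {n} (λ u → ∑-cong {n} (λ v → cong ⟦_⟧ (sy (true ∷ u) (false ∷ v)))))
                     (∑-swap (λ u v → ⟦ R (false ∷ v) (true ∷ u) ⟧))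
  rearrange : ∀ k m l → (k + k + m) + (m + (l + l)) ≡ k + m + l + (k + m + l)
  rearrange = solve-∀

-- The alternatives `P` and `Q` are arbitrary, so searches can be nested: in `edge?` the outer `Q`
-- is the universal outcome of the inner search.
search : {P Q : V n → Set} → (∀ v → P v ⊎ Q v) → ∃ P ⊎ (∀ v → Q v)
search {zero} d with d []
... | inj₁ p = inj₁ ([] , p)
... | inj₂ q = inj₂ λ { [] → q }
search {suc n} d with search (d ∘ (false ∷_)) | search (d ∘ (true ∷_))
... | inj₁ (v , p) | _            = inj₁ (false ∷ v , p)
... | inj₂ _       | inj₁ (v , p) = inj₁ (true ∷ v , p)
... | inj₂ q₀      | inj₂ q₁      = inj₂ λ { (false ∷ v) → q₀ v ; (true ∷ v) → q₁ v }

true-or-false : (b : Bool) → b ≡ true ⊎ b ≡ false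
true-or-false true  = inj₁ refl
true-or-false false = inj₂ refl

-- Sizes and induced edges of vertex sets.

size : VSet n → ℕ
size X = ∑ (λ v → ⟦ X v ⟧)

∑₂ : (V n → V n → Bool) → ℕ
∑₂ R = ∑ (λ u → ∑ (λ v → ⟦ R u v ⟧))

-- Ordered pairs are counted, so this is twice the number of induced edges.
edges : VSet n → ℕ
edges X = ∑₂ (λ u v → X u ∧ X v ∧ adjFQ u v)

size-full : size {n} (λ _ → true) ≡ 2 ^ n
size-full {n} = ∑-one n

nonempty⇒size : (X : VSet n) (z : V n) → X z ≡ true → 1 ≤ size X
nonempty⇒size X z Xz = subst (_≤ size X) (∑-singleton z) (∑-mono le)
  where
  le : ∀ v → ⟦ z == v ⟧ ≤ ⟦ X v ⟧
  le v with z == v in eq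
  ... | false = z≤n
  ... | true with refl ← ==⇒≡ z v eq rewrite Xz = ≤-refl

size⇒nonempty : (X : VSet n) → 1 ≤ size X → ∃ λ v → X v ≡ true
size⇒nonempty {n} X 1≤ with search (λ v → true-or-false (X v))
... | inj₁ r = r
... | inj₂ none = contradiction (trans (∑-cong (λ v → cong ⟦_⟧ (none v))) (∑-zero {n})) (>⇒≢ 1≤)

size<⇒missing : (X : VSet n) → size X < 2 ^ n → ∃ λ v → X v ≡ false
size<⇒missing {n} X lt with search (λ v → swap (true-or-false (X v)))
... | inj₁ r = r
... | inj₂ all = contradiction (trans (∑-cong (λ v → cong ⟦_⟧ (all v))) (size-full {n})) (<⇒≢ lt)

_∪_ _∩_ _─_ : VSet n → VSet n → VSet n
(X ∪ Y) v = X v ∨ Y v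
(X ∩ Y) v = X v ∧ Y v
(X ─ Y) v = X v ∧ not (Y v)

size-∪∩ : (X Y : VSet n) → size (X ∪ Y) + size (X ∩ Y) ≡ size X + size Y
size-∪∩ X Y = begin
  size (X ∪ Y) + size (X ∩ Y)                  ≡⟨ ∑-+ (λ v → ⟦ X v ∨ Y v ⟧) (λ v → ⟦ X v ∧ Y v ⟧) ⟨
  ∑ (λ v → ⟦ X v ∨ Y v ⟧ + ⟦ X v ∧ Y v ⟧)      ≡⟨ ∑-cong (λ v → modular (X v) (Y v)) ⟩
  ∑ (λ v → ⟦ X v ⟧ + ⟦ Y v ⟧)                  ≡⟨ ∑-+ (λ v → ⟦ X v ⟧) (λ v → ⟦ Y v ⟧) ⟩
  size X + size Y ∎
  where
  open ≡-Reasoning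
  modular : ∀ a b → ⟦ a ∨ b ⟧ + ⟦ a ∧ b ⟧ ≡ ⟦ a ⟧ + ⟦ b ⟧
  modular false b = +-identityʳ ⟦ b ⟧
  modular true  b = refl

size-─ : (X Y : VSet n) → size (X ─ Y) + size (X ∩ Y) ≡ size X
size-─ X Y = trans (sym (∑-+ (λ v → ⟦ X v ∧ not (Y v) ⟧) (λ v → ⟦ X v ∧ Y v ⟧)))
                   (∑-cong (λ v → split (X v) (Y v)))
  where
  split : ∀ a b → ⟦ a ∧ not b ⟧ + ⟦ a ∧ b ⟧ ≡ ⟦ a ⟧
  split false b     = refl
  split true  false = refl
  split true  true  = refl

size-insert : (X : VSet n) (z : V n) → X z ≡ false → size (X ∪ (z ==_)) ≡ suc (size X)
size-insert {n} X z Xz = begin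
  size (X ∪ (z ==_))                       ≡⟨ +-identityʳ _ ⟨
  size (X ∪ (z ==_)) + 0                   ≡⟨ cong (size (X ∪ (z ==_)) +_) (trans (∑-cong disjoint) (∑-zero {n})) ⟨
  size (X ∪ (z ==_)) + size (X ∩ (z ==_))  ≡⟨ size-∪∩ X (z ==_) ⟩
  size X + size (z ==_)                    ≡⟨ cong (size X +_) (∑-singleton z) ⟩
  size X + 1                               ≡⟨ +-comm (size X) 1 ⟩
  suc (size X) ∎
  where
  open ≡-Reasoning
  disjoint : ∀ v → ⟦ X v ∧ (z == v) ⟧ ≡ 0
  disjoint v with z == v in eq
  ... | false with X v
  ...   | false = refl
  ...   | true  = refl
  disjoint v | true with refl ← ==⇒≡ z v eq rewrite Xz = refl

size-remove : (X : VSet n) (z : V n) → X z ≡ true → size X ≡ suc (size (X ─ (z ==_)))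
size-remove X z Xz = begin
  size X                                    ≡⟨ size-─ X (z ==_) ⟨
  size (X ─ (z ==_)) + size (X ∩ (z ==_))   ≡⟨ cong (size (X ─ (z ==_)) +_) (trans (∑-cong only) (∑-singleton z)) ⟩
  size (X ─ (z ==_)) + 1                    ≡⟨ +-comm _ 1 ⟩
  suc (size (X ─ (z ==_))) ∎
  where
  open ≡-Reasoning
  only : ∀ v → ⟦ X v ∧ (z == v) ⟧ ≡ ⟦ z == v ⟧
  only v with z == v in eq
  ... | false with X v
  ...   | false = refl
  ...   | true  = refl
  only v | true with refl ← ==⇒≡ z v eq rewrite Xz = refl

-- From counts over lists to sums over the cube.

countB≡sum : ∀ {A : Set} (p : A → Bool) xs → countB p xs ≡ sum (map (⟦_⟧ ∘ p) xs)
countB≡sum p []       = refl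
countB≡sum p (x ∷ xs) with p x
... | true  = cong suc (countB≡sum p xs)
... | false = countB≡sum p xs

sum-allV : (f : V n → ℕ) → sum (map f (allV n)) ≡ ∑ f
sum-allV {zero}  f = +-identityʳ (f [])
sum-allV {suc n} f
  rewrite map-++ f (map (false ∷_) (allV n)) (map (true ∷_) (allV n))
        | sum-++ (map f (map (false ∷_) (allV n))) (map f (map (true ∷_) (allV n)))
        | sym (map-∘ {g = f} {f = false ∷_} (allV n))
        | sym (map-∘ {g = f} {f = true ∷_} (allV n))
  = cong₂ _+_ (sum-allV (f ∘ (false ∷_))) (sum-allV (f ∘ (true ∷_)))

card≡size : (X : VSet n) → card X ≡ size X
card≡size {n} X = trans (countB≡sum X (allV n)) (sum-allV (⟦_⟧ ∘ X))

sum-product : ∀ {A B : Set} (f : A × B → ℕ) (ys : List B) (xs : List A) →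
  sum (map f (concatMap (λ x → map (λ y → (x , y)) ys) xs)) ≡ sum (map (λ x → sum (map (λ y → f (x , y)) ys)) xs)
sum-product f ys []       = refl
sum-product f ys (x ∷ xs)
  rewrite map-++ f (map (λ y → (x , y)) ys) (concatMap (λ x → map (λ y → (x , y)) ys) xs)
        | sum-++ (map f (map (λ y → (x , y)) ys)) (map f (concatMap (λ x → map (λ y → (x , y)) ys) xs))
        | sym (map-∘ {g = f} {f = λ y → (x , y)} ys)
  = cong (sum (map (λ y → f (x , y)) ys) +_) (sum-product f ys xs)

countB-allPairs : (p : V n × V n → Bool) → countB p (allPairs n) ≡ ∑₂ (λ u v → p (u , v))
countB-allPairs {n} p = begin
  countB p (allPairs n)
    ≡⟨ countB≡sum p (allPairs n) ⟩
  sum (map (⟦_⟧ ∘ p) (allPairs n))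
    ≡⟨ sum-product (⟦_⟧ ∘ p) (allV n) (allV n) ⟩
  sum (map (λ u → sum (map (λ v → ⟦ p (u , v) ⟧) (allV n))) (allV n))
    ≡⟨ sum-allV (λ u → sum (map (λ v → ⟦ p (u , v) ⟧) (allV n))) ⟩
  ∑ (λ u → sum (map (λ v → ⟦ p (u , v) ⟧) (allV n)))
    ≡⟨ ∑-cong (λ u → sum-allV (λ v → ⟦ p (u , v) ⟧)) ⟩
  ∑₂ (λ u v → p (u , v)) ∎
  where open ≡-Reasoning

-- Adjacency and degrees in the folded hypercube.

comp-involutive : (u : V n) → comp (comp u) ≡ u
comp-involutive []      = refl
comp-involutive (b ∷ u) = cong₂ _∷_ (not-involutive b) (comp-involutive u)

ham-comp-comp : (u v : V n) → ham (comp u) (comp v) ≡ ham u v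
ham-comp-comp []          []          = refl
ham-comp-comp (false ∷ u) (false ∷ v) = ham-comp-comp u v
ham-comp-comp (false ∷ u) (true  ∷ v) = cong suc (ham-comp-comp u v)
ham-comp-comp (true  ∷ u) (false ∷ v) = cong suc (ham-comp-comp u v)
ham-comp-comp (true  ∷ u) (true  ∷ v) = ham-comp-comp u v

ham-comp-move : (u v : V n) → ham u (comp v) ≡ ham (comp u) v
ham-comp-move u v = trans (sym (ham-comp-comp u (comp v))) (cong (ham (comp u)) (comp-involutive v))

ham+ham-comp : (u v : V n) → ham u v + ham u (comp v) ≡ n
ham+ham-comp []          []          = refl
ham+ham-comp (false ∷ u) (false ∷ v) = trans (+-suc _ _) (cong suc (ham+ham-comp u v))
ham+ham-comp (false ∷ u) (true  ∷ v) = cong suc (ham+ham-comp u v)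
ham+ham-comp (true  ∷ u) (false ∷ v) = cong suc (ham+ham-comp u v)
ham+ham-comp (true  ∷ u) (true  ∷ v) = trans (+-suc _ _) (cong suc (ham+ham-comp u v))

adj-sym : (u v : V n) → adjFQ u v ≡ adjFQ v u
adj-sym u v = cong₂ (λ a b → (a ≡ᵇ 1) ∨ (b ≡ᵇ 0)) (ham-sym u v)
  (trans (ham-comp-move u v) (ham-sym (comp u) v))

-- The distance from a vertex to its complement is the dimension. This has to be positive: the only
-- vertex of the 0-cube is its own complement and hence adjacent to itself.
adj-irrefl : (u : V (suc n)) → adjFQ u u ≡ false
adj-irrefl u with ham u u | ham-refl u | ham+ham-comp u u
... | _ | refl | e rewrite e = refl

count-ham≡1 : (u : V n) → ∑ (λ v → ⟦ ham u v ≡ᵇ 1 ⟧) ≡ n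
count-ham≡1 []          = refl
count-ham≡1 (false ∷ u) = trans (cong₂ _+_ (count-ham≡1 u) (∑-singleton u)) (+-comm _ 1)
count-ham≡1 (true  ∷ u) = cong₂ _+_ (∑-singleton u) (count-ham≡1 u)

degree : 2 ≤ n → (u : V n) → ∑ (λ v → ⟦ adjFQ u v ⟧) ≡ n + 1
degree {n} 2≤n u = begin
  ∑ (λ v → ⟦ adjFQ u v ⟧)
    ≡⟨ ∑-cong (λ v → disjoint (ham u v) (ham u (comp v)) (ham+ham-comp u v)) ⟩
  ∑ (λ v → ⟦ ham u v ≡ᵇ 1 ⟧ + ⟦ u == comp v ⟧)
    ≡⟨ ∑-+ (λ v → ⟦ ham u v ≡ᵇ 1 ⟧) (λ v → ⟦ u == comp v ⟧) ⟩
  ∑ (λ v → ⟦ ham u v ≡ᵇ 1 ⟧) + ∑ (λ v → ⟦ u == comp v ⟧)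
    ≡⟨ cong₂ _+_ (count-ham≡1 u) (∑-reindex comp comp-involutive (λ v → ⟦ u == v ⟧)) ⟩
  n + ∑ (λ v → ⟦ u == v ⟧)
    ≡⟨ cong (n +_) (∑-singleton u) ⟩
  n + 1 ∎
  where
  open ≡-Reasoning
  disjoint : ∀ a b → a + b ≡ n → ⟦ (a ≡ᵇ 1) ∨ (b ≡ᵇ 0) ⟧ ≡ ⟦ a ≡ᵇ 1 ⟧ + ⟦ b ≡ᵇ 0 ⟧
  disjoint 0             b       _ = refl
  -- A vertex both at distance 1 and antipodal would force dimension 1.
  disjoint 1             zero    e = contradiction e (<⇒≢ 2≤n)
  disjoint 1             (suc b) _ = refl
  disjoint (suc (suc a)) b       _ = refl

-- Automorphisms: flips, twists and translations.

flip : Fin n → V n → V n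
flip i u = updateAt u i not

flip-involutive : (i : Fin n) (u : V n) → flip i (flip i u) ≡ u
flip-involutive zero    (b ∷ u) = cong (_∷ u) (not-involutive b)
flip-involutive (suc i) (b ∷ u) = cong (b ∷_) (flip-involutive i u)

comp-flip : (i : Fin n) (u : V n) → comp (flip i u) ≡ flip i (comp u)
comp-flip zero    (b ∷ u) = refl
comp-flip (suc i) (b ∷ u) = cong (not b ∷_) (comp-flip i u)

lookup-flip : (i : Fin n) (u : V n) → lookup (flip i u) i ≡ not (lookup u i)
lookup-flip i u = lookup∘updateAt i u

lookup-comp : (u : V n) (i : Fin n) → lookup (comp u) i ≡ not (lookup u i)
lookup-comp (b ∷ u) zero    = refl
lookup-comp (b ∷ u) (suc i) = lookup-comp u i

ham-flip-flip : (i : Fin n) (u v : V n) → ham (flip i u) (flip i v) ≡ ham u v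
ham-flip-flip zero    (false ∷ u) (false ∷ v) = refl
ham-flip-flip zero    (false ∷ u) (true  ∷ v) = refl
ham-flip-flip zero    (true  ∷ u) (false ∷ v) = refl
ham-flip-flip zero    (true  ∷ u) (true  ∷ v) = refl
ham-flip-flip (suc i) (false ∷ u) (false ∷ v) = ham-flip-flip i u v
ham-flip-flip (suc i) (false ∷ u) (true  ∷ v) = cong suc (ham-flip-flip i u v)
ham-flip-flip (suc i) (true  ∷ u) (false ∷ v) = cong suc (ham-flip-flip i u v)
ham-flip-flip (suc i) (true  ∷ u) (true  ∷ v) = ham-flip-flip i u v

ham-flip : (i : Fin n) (u v : V n) → lookup u i ≡ lookup v i → ham u (flip i v) ≡ suc (ham u v)
ham-flip zero    (false ∷ u) (false ∷ v) _ = refl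
ham-flip zero    (true  ∷ u) (true  ∷ v) _ = refl
ham-flip (suc i) (false ∷ u) (false ∷ v) e = ham-flip i u v e
ham-flip (suc i) (false ∷ u) (true  ∷ v) e = cong suc (ham-flip i u v e)
ham-flip (suc i) (true  ∷ u) (false ∷ v) e = cong suc (ham-flip i u v e)
ham-flip (suc i) (true  ∷ u) (true  ∷ v) e = ham-flip i u v e

adj-flip-flip : (i : Fin n) (u v : V n) → adjFQ (flip i u) (flip i v) ≡ adjFQ u v
adj-flip-flip i u v rewrite comp-flip i v | ham-flip-flip i u v | ham-flip-flip i u (comp v) = refl

adj-comp-comp : (u v : V n) → adjFQ (comp u) (comp v) ≡ adjFQ u v
adj-comp-comp u v rewrite ham-comp-comp u v | ham-comp-comp u (comp v) = refl

-- The two ways of being adjacent trade places: `u` is at distance 1 from `flip i w` exactly when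
-- `u` equals `w`, the complement of `comp w`, and `u` is antipodal to `flip i w` exactly when it is
-- at distance 1 from `comp w`.
adj-flip≡adj-comp : (i : Fin n) (u w : V n) → lookup u i ≡ lookup w i →
  adjFQ u (flip i w) ≡ adjFQ u (comp w)
adj-flip≡adj-comp i u w e = begin
  adjFQ u (flip i w)                                ≡⟨ cong (λ a → (a ≡ᵇ 1) ∨ (u == comp (flip i w))) (ham-flip i u w e) ⟩
  (u == w) ∨ (u == comp (flip i w))                 ≡⟨ ∨-comm (u == w) _ ⟩
  (u == comp (flip i w)) ∨ (u == w)                 ≡⟨ cong₂ (λ a z → (a ≡ᵇ 1) ∨ (u == z)) (sym opposite) (sym (comp-involutive w)) ⟩
  adjFQ u (comp w) ∎
  where
  open ≡-Reasoning
  opposite : ham u (comp w) ≡ suc (ham u (comp (flip i w)))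
  opposite = trans (cong (ham u) (trans (cong comp (sym (flip-involutive i w))) (comp-flip i (flip i w))))
    (ham-flip i u (comp (flip i w))
      (trans e (sym (trans (lookup-comp (flip i w) i) (trans (cong not (lookup-flip i w)) (not-involutive _))))))

-- The linear involution of 𝔽₂ⁿ exchanging the i-th unit vector with the all-ones vector
-- and fixing the other unit vectors.
twist : Fin n → V n → V n
twist i u = if lookup u i then comp (flip i u) else u

twist-true : (i : Fin n) (u : V n) → lookup u i ≡ true → twist i u ≡ comp (flip i u)
twist-true i u e rewrite e = refl

twist-false : (i : Fin n) (u : V n) → lookup u i ≡ false → twist i u ≡ u
twist-false i u e rewrite e = refl

lookup-comp-flip : (i : Fin n) (u : V n) → lookup (comp (flip i u)) i ≡ lookup u i
lookup-comp-flip i u =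
  trans (lookup-comp (flip i u) i) (trans (cong not (lookup-flip i u)) (not-involutive _))

comp-flip-involutive : (i : Fin n) (u : V n) → comp (flip i (comp (flip i u))) ≡ u
comp-flip-involutive i u =
  trans (comp-flip i _) (trans (cong (flip i) (comp-involutive _)) (flip-involutive i u))

twist-involutive : (i : Fin n) (u : V n) → twist i (twist i u) ≡ u
twist-involutive i u with true-or-false (lookup u i)
... | inj₁ t = trans (cong (twist i) (twist-true i u t))
  (trans (twist-true i _ (trans (lookup-comp-flip i u) t)) (comp-flip-involutive i u))
... | inj₂ f = trans (cong (twist i) (twist-false i u f)) (twist-false i u f)

-- The twist turns a hypercube edge in direction `i` into a complementary pair, which brings both
-- kinds of edges to one form.
twist-flip : (i : Fin n) (u : V n) → twist i (flip i u) ≡ comp (twist i u)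
twist-flip i u with true-or-false (lookup u i)
... | inj₁ t = trans (twist-false i (flip i u) (trans (lookup-flip i u) (cong not t)))
  (trans (sym (comp-involutive _)) (cong comp (sym (twist-true i u t))))
... | inj₂ f = trans (twist-true i (flip i u) (trans (lookup-flip i u) (cong not f)))
  (trans (cong comp (flip-involutive i u)) (cong comp (sym (twist-false i u f))))

-- If `u` and `v` agree at `i`, the same automorphism, `comp` after `flip i` or the identity, acts
-- on both. If they differ, only one of them moves, and `adj-flip≡adj-comp` turns its `comp` into a
-- second `flip i` that cancels the first.
twist-adj : (i : Fin n) (u v : V n) → adjFQ (twist i u) (twist i v) ≡ adjFQ u v
twist-adj i u v with true-or-false (lookup u i) | true-or-false (lookup v i)
... | inj₁ p | inj₁ q rewrite twist-true i u p | twist-true i v q =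
  trans (adj-comp-comp (flip i u) (flip i v)) (adj-flip-flip i u v)
... | inj₂ p | inj₂ q rewrite twist-false i u p | twist-false i v q = refl
... | inj₂ p | inj₁ q rewrite twist-false i u p | twist-true i v q =
  trans (sym (adj-flip≡adj-comp i u (flip i v) (trans p (sym (trans (lookup-flip i v) (cong not q))))))
        (cong (adjFQ u) (flip-involutive i v))
... | inj₁ p | inj₂ q rewrite twist-true i u p | twist-false i v q =
  trans (adj-sym (comp (flip i u)) v)
  (trans (sym (adj-flip≡adj-comp i v (flip i u) (trans q (sym (trans (lookup-flip i u) (cong not p))))))
  (trans (cong (adjFQ v) (flip-involutive i u)) (adj-sym v u)))

translate : V n → V n → V n
translate = zipWith _xor_

translate-involutive : (t u : V n) → translate t (translate t u) ≡ u
translate-involutive []          []      = refl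
translate-involutive (false ∷ t) (b ∷ u) = cong (b ∷_) (translate-involutive t u)
translate-involutive (true  ∷ t) (b ∷ u) = cong₂ _∷_ (not-involutive b) (translate-involutive t u)

translate-comp : (t u : V n) → translate t (comp u) ≡ comp (translate t u)
translate-comp []          []      = refl
translate-comp (false ∷ t) (b ∷ u) = cong (not b ∷_) (translate-comp t u)
translate-comp (true  ∷ t) (b ∷ u) = cong (not (not b) ∷_) (translate-comp t u)

translate-between : (x y : V n) → translate (translate x y) x ≡ y
translate-between []          []          = refl
translate-between (false ∷ x) (false ∷ y) = cong (false ∷_) (translate-between x y)
translate-between (false ∷ x) (true  ∷ y) = cong (true  ∷_) (translate-between x y)
translate-between (true  ∷ x) (false ∷ y) = cong (false ∷_) (translate-between x y)
translate-between (true  ∷ x) (true  ∷ y) = cong (true  ∷_) (translate-between x y)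

ham-translate : (t u v : V n) → ham (translate t u) (translate t v) ≡ ham u v
ham-translate []          []          []          = refl
ham-translate (false ∷ t) (false ∷ u) (false ∷ v) = ham-translate t u v
ham-translate (false ∷ t) (false ∷ u) (true  ∷ v) = cong suc (ham-translate t u v)
ham-translate (false ∷ t) (true  ∷ u) (false ∷ v) = cong suc (ham-translate t u v)
ham-translate (false ∷ t) (true  ∷ u) (true  ∷ v) = ham-translate t u v
ham-translate (true  ∷ t) (false ∷ u) (false ∷ v) = ham-translate t u v
ham-translate (true  ∷ t) (false ∷ u) (true  ∷ v) = cong suc (ham-translate t u v)
ham-translate (true  ∷ t) (true  ∷ u) (false ∷ v) = cong suc (ham-translate t u v)
ham-translate (true  ∷ t) (true  ∷ u) (true  ∷ v) = ham-translate t u v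

translate-adj : (t u v : V n) → adjFQ (translate t u) (translate t v) ≡ adjFQ u v
translate-adj t u v rewrite sym (translate-comp t v) | ham-translate t u v | ham-translate t u (comp v) = refl

size-reindex : (φ : V n → V n) → (∀ v → φ (φ v) ≡ v) → (X : VSet n) → size (X ∘ φ) ≡ size X
size-reindex φ inv X = ∑-reindex φ inv (⟦_⟧ ∘ X)

edges-reindex : (φ : V n → V n) → (∀ v → φ (φ v) ≡ v) → (∀ u v → adjFQ (φ u) (φ v) ≡ adjFQ u v) →
  (X : VSet n) → edges (X ∘ φ) ≡ edges X
edges-reindex φ inv pres X = begin
  edges (X ∘ φ)
    ≡⟨ ∑-cong (λ u → ∑-cong (λ v → cong (λ a → ⟦ X (φ u) ∧ X (φ v) ∧ a ⟧) (sym (pres u v)))) ⟩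
  ∑ (λ u → ∑ (λ v → ⟦ X (φ u) ∧ X (φ v) ∧ adjFQ (φ u) (φ v) ⟧))
    ≡⟨ ∑-cong (λ u → ∑-reindex φ inv (λ v → ⟦ X (φ u) ∧ X v ∧ adjFQ (φ u) v ⟧)) ⟩
  ∑ (λ u → ∑ (λ v → ⟦ X (φ u) ∧ X v ∧ adjFQ (φ u) v ⟧))
    ≡⟨ ∑-reindex φ inv (λ u → ∑ (λ v → ⟦ X u ∧ X v ∧ adjFQ u v ⟧)) ⟩
  edges X ∎
  where open ≡-Reasoning

-- Directions of edges and edges leaving a set.

adj⇒flip-or-comp : (u v : V n) → adjFQ u v ≡ true → (∃ λ i → v ≡ flip i u) ⊎ u ≡ comp v
adj⇒flip-or-comp u v a with true-or-false (ham u v ≡ᵇ 1)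
... | inj₁ e = inj₁ (one u v (≡ᵇ⇒≡ (ham u v) 1 (Equivalence.from T-≡ e)))
  where
  one : ∀ {n} (u v : V n) → ham u v ≡ 1 → ∃ λ i → v ≡ flip i u
  one []          []          ()
  one (false ∷ u) (false ∷ v) e with i , refl ← one u v e = suc i , refl
  one (true  ∷ u) (true  ∷ v) e with i , refl ← one u v e = suc i , refl
  one (false ∷ u) (true  ∷ v) e with refl ← ham≡0⇒≡ u v (suc-injective e) = zero , refl
  one (true  ∷ u) (false ∷ v) e with refl ← ham≡0⇒≡ u v (suc-injective e) = zero , refl
... | inj₂ e rewrite e = inj₂ (==⇒≡ u (comp v) a)

-- Connectedness of the cube by way of `x ∷ b`. If this vertex is outside `X`, the search continues
-- in the half-cube of `x`; if it is inside, flipping its first coordinate leads to `y ∷ b`, out of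
-- `X`.
boundary-edge : (X : VSet n) (a b : V n) → X a ≡ true → X b ≡ false →
  ∃₂ λ i u → X u ≡ true × X (flip i u) ≡ false
boundary-edge X [] [] p q = contradiction (trans (sym p) q) λ ()
boundary-edge X (x ∷ a) (y ∷ b) p q with true-or-false (X (x ∷ b))
... | inj₂ f with i , u , r , s ← boundary-edge (X ∘ (x ∷_)) a b p f = suc i , x ∷ u , r , s
boundary-edge X (false ∷ a) (true  ∷ b) p q | inj₁ t = zero , false ∷ b , t , q
boundary-edge X (true  ∷ a) (false ∷ b) p q | inj₁ t = zero , true ∷ b , t , q
boundary-edge X (false ∷ a) (false ∷ b) p q | inj₁ t = contradiction (trans (sym t) q) λ ()
boundary-edge X (true  ∷ a) (true  ∷ b) p q | inj₁ t = contradiction (trans (sym t) q) λ ()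

-- Supermodularity of the induced edge count.

∑∑-+ : (f g : V n → V n → ℕ) →
  ∑ (λ u → ∑ (λ v → f u v + g u v)) ≡ ∑ (λ u → ∑ (f u)) + ∑ (λ u → ∑ (g u))
∑∑-+ f g = trans (∑-cong (λ u → ∑-+ (f u) (g u))) (∑-+ (λ u → ∑ (f u)) (λ u → ∑ (g u)))

-- The inequality holds pair by pair: a pair inside one set is inside the union, and a pair inside
-- both is also inside the intersection. Only pairs running between `X ─ Y` and `Y ─ X` make it
-- strict.
edges-∪∩ : (X Y : VSet n) → edges X + edges Y ≤ edges (X ∪ Y) + edges (X ∩ Y)
edges-∪∩ X Y = begin
  edges X + edges Y
    ≡⟨ ∑∑-+ (λ u v → ⟦ X u ∧ X v ∧ adjFQ u v ⟧) (λ u v → ⟦ Y u ∧ Y v ∧ adjFQ u v ⟧) ⟨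
  ∑ (λ u → ∑ (λ v → ⟦ X u ∧ X v ∧ adjFQ u v ⟧ + ⟦ Y u ∧ Y v ∧ adjFQ u v ⟧))
    ≤⟨ ∑-mono (λ u → ∑-mono (λ v → supermodular (X u) (X v) (Y u) (Y v) (adjFQ u v))) ⟩
  ∑ (λ u → ∑ (λ v → ⟦ (X ∪ Y) u ∧ (X ∪ Y) v ∧ adjFQ u v ⟧ + ⟦ (X ∩ Y) u ∧ (X ∩ Y) v ∧ adjFQ u v ⟧))
    ≡⟨ ∑∑-+ (λ u v → ⟦ (X ∪ Y) u ∧ (X ∪ Y) v ∧ adjFQ u v ⟧) (λ u v → ⟦ (X ∩ Y) u ∧ (X ∩ Y) v ∧ adjFQ u v ⟧) ⟩
  edges (X ∪ Y) + edges (X ∩ Y) ∎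
  where
  open ≤-Reasoning
  supermodular : ∀ x x′ y y′ a →
    ⟦ x ∧ x′ ∧ a ⟧ + ⟦ y ∧ y′ ∧ a ⟧ ≤ ⟦ (x ∨ y) ∧ (x′ ∨ y′) ∧ a ⟧ + ⟦ (x ∧ y) ∧ (x′ ∧ y′) ∧ a ⟧
  supermodular false x′    false y′    a = z≤n
  supermodular false x′    true  false a = z≤n
  supermodular false x′    true  true  a rewrite ∨-zeroʳ x′ = m≤m+n ⟦ a ⟧ 0
  supermodular true  false false y′    a = z≤n
  supermodular true  false true  y′    a = ≤-reflexive (sym (+-identityʳ _))
  supermodular true  true  false y′    a = ≤-refl
  supermodular true  true  true  y′    a = ≤-refl

edges-mono : {X Y : VSet n} → (∀ v → X v ≡ true → Y v ≡ true) → edges X ≤ edges Y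
edges-mono {X = X} {Y} X⊆Y = ∑-mono (λ u → ∑-mono (le u))
  where
  le : ∀ u v → ⟦ X u ∧ X v ∧ adjFQ u v ⟧ ≤ ⟦ Y u ∧ Y v ∧ adjFQ u v ⟧
  le u v with X u in p | X v in q
  ... | false | _     = z≤n
  ... | true  | false = z≤n
  ... | true  | true rewrite X⊆Y u p | X⊆Y v q = ≤-refl

-- Moving sets by automorphisms.

∧-true : ∀ {a b} → a ∧ b ≡ true → a ≡ true × b ≡ true
∧-true {true} {true} _ = refl , refl

Edge : VSet n → Set
Edge X = ∃₂ λ u v → X u ≡ true × X v ≡ true × adjFQ u v ≡ true

edge? : (X : VSet n) → Edge X ⊎ edges X ≡ 0
edge? {n} X with search (λ u → search (λ v → true-or-false (X u ∧ X v ∧ adjFQ u v)))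
... | inj₁ (u , v , e) with p , e′ ← ∧-true e with q , a ← ∧-true e′ = inj₁ (u , v , p , q , a)
... | inj₂ none =
  inj₂ (trans (∑-cong (λ u → trans (∑-cong (λ v → cong ⟦_⟧ (none u v))) (∑-zero {n}))) (∑-zero {n}))

edge⇒2≤size : (X : VSet (suc n)) → Edge X → 2 ≤ size X
edge⇒2≤size X (u , v , p , q , a) =
  subst (2 ≤_) (sym (size-remove X u p)) (s≤s (nonempty⇒size (X ─ (u ==_)) v v∈))
  where
  v∈ : X v ∧ not (u == v) ≡ true
  v∈ rewrite q with u == v in e
  ... | false = refl
  ... | true with refl ← ==⇒≡ u v e = contradiction (trans (sym a) (adj-irrefl u)) λ ()

-- Only these two invariants matter for merging, so a set may be replaced by any automorphic image.
_≈_ : VSet n → VSet n → Set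
X ≈ Y = size X ≡ size Y × edges X ≡ edges Y

≈-twist : (i : Fin n) (X : VSet n) → (X ∘ twist i) ≈ X
≈-twist i X = size-reindex (twist i) (twist-involutive i) X
            , edges-reindex (twist i) (twist-involutive i) (twist-adj i) X

≈-translate : (t : V n) (X : VSet n) → (X ∘ translate t) ≈ X
≈-translate t X = size-reindex (translate t) (translate-involutive t) X
                , edges-reindex (translate t) (translate-involutive t) (translate-adj t) X

twist-comp-twist : (i : Fin n) (u : V n) → twist i (comp (twist i u)) ≡ flip i u
twist-comp-twist i u = trans (cong (twist i) (sym (twist-flip i u))) (twist-involutive i (flip i u))

-- A twist in the direction of the edge makes its ends complementary. Once the edge of one set and
-- the boundary edge of another both have this form, matching one end by a translation matches the
-- other as well, since translations commute with `comp`.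
edge⇒comp-edge : (X : VSet n) → Edge X →
  ∃ λ X′ → X′ ≈ X × ∃ λ x → X′ x ≡ true × X′ (comp x) ≡ true
edge⇒comp-edge X (u , v , p , q , a) with adj⇒flip-or-comp u v a
... | inj₂ refl = X , (refl , refl) , v , q , p
... | inj₁ (i , refl) = X ∘ twist i , ≈-twist i X , twist i u
    , trans (cong X (twist-involutive i u)) p
    , trans (cong X (twist-comp-twist i u)) q

proper⇒comp-boundary : (X : VSet n) (a b : V n) → X a ≡ true → X b ≡ false →
  ∃ λ X′ → X′ ≈ X × ∃ λ y → X′ y ≡ true × X′ (comp y) ≡ false
proper⇒comp-boundary X a b p q with i , u , r , s ← boundary-edge X a b p q =
  X ∘ twist i , ≈-twist i X , twist i u
    , trans (cong X (twist-involutive i u)) r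
    , trans (cong X (twist-comp-twist i u)) s

-- By arc-transitivity an edge of B can be carried onto an edge leaving A.
cross : (A B : VSet n) (a b : V n) → A a ≡ true → A b ≡ false → Edge B →
  ∃₂ λ A′ B′ → A′ ≈ A × B′ ≈ B ×
    (∃ λ v → B′ v ≡ true × A′ v ≡ true) × (∃ λ v → B′ v ≡ true × A′ v ≡ false)
cross A B a b p q e
  with A′ , A′≈A , y , r , s ← proper⇒comp-boundary A a b p q
     | B′ , (sz , ed) , x , r′ , s′ ← edge⇒comp-edge B e
  = A′ , B′ ∘ τ , A′≈A , (trans (proj₁ (≈-translate t B′)) sz , trans (proj₂ (≈-translate t B′)) ed)
  , (y , trans (cong B′ (translate-between y x)) r′ , r)
  , (comp y , trans (cong B′ (trans (translate-comp t y) (cong comp (translate-between y x)))) s′ , s)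
  where
  t = translate y x
  τ = translate t

-- Merging two sets at the cost of one vertex.

-- Induction on the bound `b` for `size B`, which drops with every call while the total size stays
-- fixed. The bound on the total keeps `A` proper as long as `B` has at least two vertices.
merge : ∀ b (A B : VSet (suc n)) → size B ≤ b → 1 ≤ size A → 1 ≤ size B →
  size A + size B ≤ suc (2 ^ suc n) →
  Σ (VSet (suc n)) λ C → suc (size C) ≡ size A + size B × edges A + edges B ≤ edges C
merge zero    A B B≤b 1≤A 1≤B A+B≤ = contradiction (≤-trans 1≤B B≤b) λ ()
merge {n} (suc b) A B B≤b 1≤A 1≤B A+B≤ with edge? B
merge {n} (suc b) A B B≤b 1≤A 1≤B A+B≤ | inj₂ e≡0 with size B ≤? 1
-- For a one-vertex `B` the required size is that of `A` itself.
... | yes B≤1 = A , trans (+-comm 1 (size A)) (cong (size A +_) (≤-antisym 1≤B B≤1))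
              , ≤-reflexive (trans (cong (edges A +_) e≡0) (+-identityʳ _))
-- An edgeless `B` is dissolved vertex by vertex: `z` leaves `B`, and some `y` outside `A` joins
-- `A`, where it can only add edges.
... | no B≰1
  with y , y∉ ← size<⇒missing A (s≤s⁻¹ (≤-trans (subst (_≤ size A + size B) (+-comm (size A) 2) (+-monoʳ-≤ (size A) (≰⇒> B≰1))) A+B≤))
     | z , z∈ ← size⇒nonempty B 1≤B
  = let A′ = A ∪ (y ==_)
        B′ = B ─ (z ==_)
        sA = size-insert A y y∉
        sB = size-remove B z z∈
        A′+B′ : size A′ + size B′ ≡ size A + size B
        A′+B′ = trans (cong (_+ size B′) sA) (trans (sym (+-suc _ _)) (cong (size A +_) (sym sB)))
        C , sC , eC = merge b A′ B′
          (s≤s⁻¹ (subst (_≤ suc b) sB B≤b))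
          (subst (1 ≤_) (sym sA) (s≤s z≤n))
          (s≤s⁻¹ (subst (2 ≤_) sB (≰⇒> B≰1)))
          (subst (_≤ suc (2 ^ suc n)) (sym A′+B′) A+B≤)
    in C , trans sC A′+B′ , (begin
         edges A + edges B   ≡⟨ trans (cong (edges A +_) e≡0) (+-identityʳ _) ⟩
         edges A             ≤⟨ edges-mono {X = A} {A′} (λ v p → cong (_∨ (y == v)) p) ⟩
         edges A′            ≤⟨ m≤m+n (edges A′) (edges B′) ⟩
         edges A′ + edges B′ ≤⟨ eC ⟩
         edges C ∎)
  where open ≤-Reasoning
merge {n} (suc b) A B B≤b 1≤A 1≤B A+B≤ | inj₁ edge
  with a , a∈ ← size⇒nonempty A 1≤A
     | y , y∉ ← size<⇒missing A (s≤s⁻¹ (≤-trans (subst (_≤ size A + size B) (+-comm (size A) 2) (+-monoʳ-≤ (size A) (edge⇒2≤size B edge))) A+B≤))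
  with A′ , B′ , (sA , eA) , (sB , eB) , (p , p∈B , p∈A) , (q , q∈B , q∉A) ← cross A B a y a∈ y∉ edge
  = let total : size (B′ ∪ A′) + size (B′ ∩ A′) ≡ size A + size B
        total = trans (size-∪∩ B′ A′) (trans (cong₂ _+_ sB sA) (+-comm (size B) (size A)))
        -- The vertex `q` of `B′` outside `A′` makes the intersection smaller than `B`, while the
        -- common vertex `p` keeps it nonempty.
        shrinks : size (B′ ∩ A′) < size B
        shrinks = subst (size (B′ ∩ A′) <_) (trans (size-─ B′ A′) sB)
          (+-monoˡ-≤ (size (B′ ∩ A′)) (nonempty⇒size (B′ ─ A′) q (cong₂ (λ s t → s ∧ not t) q∈B q∉A)))
        1≤∪ : 1 ≤ size (B′ ∪ A′)
        1≤∪ = nonempty⇒size (B′ ∪ A′) p (cong (_∨ A′ p) p∈B)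
        1≤∩ : 1 ≤ size (B′ ∩ A′)
        1≤∩ = nonempty⇒size (B′ ∩ A′) p (cong₂ _∧_ p∈B p∈A)
        C , sC , eC = merge b (B′ ∪ A′) (B′ ∩ A′) (s≤s⁻¹ (≤-trans shrinks B≤b)) 1≤∪ 1≤∩
          (subst (_≤ suc (2 ^ suc n)) (sym total) A+B≤)
    in C , trans sC total , (begin
         edges A + edges B                   ≡⟨ cong₂ _+_ eA eB ⟨
         edges A′ + edges B′                 ≡⟨ +-comm (edges A′) (edges B′) ⟩
         edges B′ + edges A′                 ≤⟨ edges-∪∩ B′ A′ ⟩
         edges (B′ ∪ A′) + edges (B′ ∩ A′)   ≤⟨ eC ⟩
         edges C ∎)
  where open ≤-Reasoning

-- Counting pairs incident with a set.

∑₂-incidentˡ : 2 ≤ n → (X : VSet n) → ∑₂ (λ u v → X u ∧ adjFQ u v) ≡ size X * (n + 1)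
∑₂-incidentˡ {n} 2≤n X = trans (∑-cong row) (∑-*ʳ (⟦_⟧ ∘ X) (n + 1))
  where
  row : ∀ u → ∑ (λ v → ⟦ X u ∧ adjFQ u v ⟧) ≡ ⟦ X u ⟧ * (n + 1)
  row u with X u
  ... | true  = trans (degree 2≤n u) (sym (+-identityʳ (n + 1)))
  ... | false = ∑-zero {n}

∑₂-incidentʳ : 2 ≤ n → (X : VSet n) → ∑₂ (λ u v → X v ∧ adjFQ u v) ≡ size X * (n + 1)
∑₂-incidentʳ 2≤n X = trans (∑-swap (λ u v → ⟦ X v ∧ adjFQ u v ⟧))
  (trans (∑-cong (λ u → ∑-cong (λ v → cong (λ a → ⟦ X u ∧ a ⟧) (adj-sym v u)))) (∑₂-incidentˡ 2≤n X))

-- Both sides count an ordered adjacent pair once for each end in `X`: on the left, a pair inside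
-- `X` appears in both terms; on the right, degrees are summed over first ends and over second ends.
∑₂-incident : 2 ≤ n → (X : VSet n) →
  ∑₂ (λ u v → adjFQ u v ∧ (X u ∨ X v)) + edges X ≡ size X * (n + 1) + size X * (n + 1)
∑₂-incident {n} 2≤n X = begin
  ∑₂ (λ u v → adjFQ u v ∧ (X u ∨ X v)) + edges X
    ≡⟨ ∑∑-+ (λ u v → ⟦ adjFQ u v ∧ (X u ∨ X v) ⟧) (λ u v → ⟦ X u ∧ X v ∧ adjFQ u v ⟧) ⟨
  ∑ (λ u → ∑ (λ v → ⟦ adjFQ u v ∧ (X u ∨ X v) ⟧ + ⟦ X u ∧ X v ∧ adjFQ u v ⟧))
    ≡⟨ ∑-cong (λ u → ∑-cong (λ v → modular (X u) (X v) (adjFQ u v))) ⟩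
  ∑ (λ u → ∑ (λ v → ⟦ X u ∧ adjFQ u v ⟧ + ⟦ X v ∧ adjFQ u v ⟧))
    ≡⟨ ∑∑-+ (λ u v → ⟦ X u ∧ adjFQ u v ⟧) (λ u v → ⟦ X v ∧ adjFQ u v ⟧) ⟩
  ∑₂ (λ u v → X u ∧ adjFQ u v) + ∑₂ (λ u v → X v ∧ adjFQ u v)
    ≡⟨ cong₂ _+_ (∑₂-incidentˡ 2≤n X) (∑₂-incidentʳ 2≤n X) ⟩
  size X * (n + 1) + size X * (n + 1) ∎
  where
  open ≡-Reasoning
  modular : ∀ x x′ a → ⟦ a ∧ (x ∨ x′) ⟧ + ⟦ x ∧ x′ ∧ a ⟧ ≡ ⟦ x ∧ a ⟧ + ⟦ x′ ∧ a ⟧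
  modular false false false = refl
  modular false false true  = refl
  modular false true  false = refl
  modular false true  true  = refl
  modular true  false false = refl
  modular true  false true  = refl
  modular true  true  false = refl
  modular true  true  true  = refl

edges-even : (X : VSet (suc n)) → ∃ λ k → edges X ≡ k + k
edges-even X = sum-symmetric-even (λ u v → X u ∧ X v ∧ adjFQ u v) sy irr
  where
  sy : ∀ u v → X u ∧ X v ∧ adjFQ u v ≡ X v ∧ X u ∧ adjFQ v u
  sy u v rewrite adj-sym v u with X u | X v
  ... | false | false = refl
  ... | false | true  = refl
  ... | true  | false = refl
  ... | true  | true  = refl
  irr : ∀ u → X u ∧ X u ∧ adjFQ u u ≡ false
  irr u rewrite adj-irrefl u with X u
  ... | false = refl
  ... | true  = refl

-- Components left by a cut and their merging.

-- Excluded middle is used under a double negation at each of the finitely many vertices. This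
-- yields components as boolean sets; the double negation is discharged in `edgeCount-lower`, where
-- the goal is decidable.
¬¬-characteristic : (P : V n → Set) →
  ¬ ¬ (Σ (VSet n) λ X → ∀ v → (X v ≡ true → P v) × (P v → X v ≡ true))
¬¬-characteristic {zero} P k = ¬¬-excluded-middle λ
  { (yes p) → k ((λ _ → true)  , λ { [] → (λ _ → p) , (λ _ → refl) })
  ; (no ¬p) → k ((λ _ → false) , λ { [] → (λ ()) , (λ p → contradiction p ¬p) }) }
¬¬-characteristic {suc n} P k =
  ¬¬-characteristic (P ∘ (false ∷_)) λ (X₀ , c₀) →
  ¬¬-characteristic (P ∘ (true ∷_)) λ (X₁ , c₁) →
  k ((λ { (false ∷ v) → X₀ v ; (true ∷ v) → X₁ v })
    , λ { (false ∷ v) → c₀ v ; (true ∷ v) → c₁ v })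

module _ (F : EdgeSet n) where

  adjDel-sym : (u v : V n) → adjDel F u v ≡ adjDel F v u
  adjDel-sym u v = cong₂ (λ a b → a ∧ not b) (adj-sym u v) (∨-comm (F u v) (F v u))

  Reach-snoc : ∀ {u v w} → Reach F u v → adjDel F v w ≡ true → Reach F u w
  Reach-snoc here       a = step (Equivalence.from T-≡ a) here
  Reach-snoc (step b r) a = step b (Reach-snoc r a)

  -- Such a `Y` is a union of components of the graph without `F`.
  Closed : VSet n → Set
  Closed Y = ∀ u v → adjDel F u v ≡ true → Y u ≡ Y v

  -- Twice the number of edges inside `Y` that survive the deletion of `F`, for positive `n`.
  uncut : VSet n → ℕ
  uncut Y = ∑₂ (λ u v → Y u ∧ Y v ∧ adjDel F u v)

  uncut≤edges : (Y : VSet n) → uncut Y ≤ edges Y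
  uncut≤edges Y = ∑-mono (λ u → ∑-mono (λ v → le (Y u) (Y v) (adjFQ u v) (F u v ∨ F v u)))
    where
    le : ∀ x y a f → ⟦ x ∧ y ∧ a ∧ not f ⟧ ≤ ⟦ x ∧ y ∧ a ⟧
    le false y     a     f     = z≤n
    le true  false a     f     = z≤n
    le true  true  false f     = z≤n
    le true  true  true  false = ≤-refl
    le true  true  true  true  = z≤n

  -- No surviving edge leaves the closed set `X`, so each one inside `Y` stays on one side.
  uncut-split : (X Y : VSet n) → Closed X → uncut Y ≤ uncut (Y ∩ X) + uncut (Y ─ X)
  uncut-split X Y cl = begin
    uncut Y
      ≤⟨ ∑-mono (λ u → ∑-mono (λ v → le u v)) ⟩
    ∑ (λ u → ∑ (λ v → ⟦ (Y ∩ X) u ∧ (Y ∩ X) v ∧ adjDel F u v ⟧ + ⟦ (Y ─ X) u ∧ (Y ─ X) v ∧ adjDel F u v ⟧))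
      ≡⟨ ∑∑-+ (λ u v → ⟦ (Y ∩ X) u ∧ (Y ∩ X) v ∧ adjDel F u v ⟧) (λ u v → ⟦ (Y ─ X) u ∧ (Y ─ X) v ∧ adjDel F u v ⟧) ⟩
    uncut (Y ∩ X) + uncut (Y ─ X) ∎
    where
    open ≤-Reasoning
    le : ∀ u v → ⟦ Y u ∧ Y v ∧ adjDel F u v ⟧
               ≤ ⟦ (Y ∩ X) u ∧ (Y ∩ X) v ∧ adjDel F u v ⟧ + ⟦ (Y ─ X) u ∧ (Y ─ X) v ∧ adjDel F u v ⟧
    le u v with Y u | Y v | adjDel F u v in a
    ... | false | _     | _     = z≤n
    ... | true  | false | _     = z≤n
    ... | true  | true  | false = z≤n
    ... | true  | true  | true  rewrite cl u v a with X v
    ...   | false = ≤-refl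
    ...   | true  = ≤-refl

≤-full : (X : VSet n) → size X ≤ 2 ^ n
≤-full {n} X = subst (size X ≤_) (size-full {n}) (∑-mono (λ v → ⟦⟧≤1 (X v)))
  where
  ⟦⟧≤1 : ∀ b → ⟦ b ⟧ ≤ 1
  ⟦⟧≤1 false = z≤n
  ⟦⟧≤1 true  = ≤-refl

-- Induction on the number of representatives. The component of the first one is split off from `Y`,
-- the rest is gathered into one set, and the two are merged. Each of the `k` merges costs one
-- vertex and no edges.
gather : (F : EdgeSet (suc n)) (k : ℕ) (Y : VSet (suc n)) (vs : Vec (V (suc n)) (suc k)) →
  Closed F Y → (∀ i → Y (lookup vs i) ≡ true) →
  (∀ i j → i ≢ j → ¬ Reach F (lookup vs i) (lookup vs j)) →
  ¬ ¬ (Σ (VSet (suc n)) λ C → size C + k ≡ size Y × 1 ≤ size C × uncut F Y ≤ edges C)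
gather F zero Y (v ∷ []) cl vs∈ sep K =
  -- The last part takes all that remains of `Y`, even if that is several components.
  K (Y , +-identityʳ _ , nonempty⇒size Y v (vs∈ zero) , uncut≤edges F Y)
gather {n} F (suc k) Y (v₀ ∷ vs) cl vs∈ sep K = ¬¬-characteristic (Reach F v₀) λ (X , X⇔) →
  let X-closed : Closed F X
      X-closed u v a = ⇔⇒≡
        (λ p → proj₂ (X⇔ v) (Reach-snoc F (proj₁ (X⇔ u) p) a))
        (λ p → proj₂ (X⇔ u) (Reach-snoc F (proj₁ (X⇔ v) p) (trans (adjDel-sym F v u) a)))
      outside : ∀ i → X (lookup vs i) ≡ false
      outside i = ¬-not (sep zero (suc i) (λ ()) ∘ proj₁ (X⇔ _))
  in gather F k (Y ─ X) vs
      (λ u v a → cong₂ (λ s t → s ∧ not t) (cl u v a) (X-closed u v a))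
      (λ i → cong₂ (λ s t → s ∧ not t) (vs∈ (suc i)) (outside i))
      (λ i j i≢j → sep (suc i) (suc j) λ { refl → i≢j refl })
      λ (C , sC , 1≤C , eC) →
  let A = Y ∩ X
      1≤A : 1 ≤ size A
      1≤A = nonempty⇒size A v₀ (cong₂ _∧_ (vs∈ zero) (proj₂ (X⇔ v₀) here))
      sizes : size A + size C + k ≡ size Y
      sizes = trans (+-assoc (size A) (size C) k)
             (trans (cong (size A +_) sC) (trans (+-comm (size A) _) (size-─ Y X)))
      D , sD , eD = merge (size C) A C ≤-refl 1≤A 1≤C
        (m≤n⇒m≤1+n (≤-trans (m+n≤o⇒m≤o (size A + size C) (≤-reflexive sizes)) (≤-full Y)))
  in K (D , trans (+-suc (size D) k) (trans (cong (_+ k) sD) sizes)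
        , s≤s⁻¹ (subst (2 ≤_) (sym sD) (+-mono-≤ 1≤A 1≤C))
        , (begin
            uncut F Y                      ≤⟨ uncut-split F X Y X-closed ⟩
            uncut F A + uncut F (Y ─ X)    ≤⟨ +-mono-≤ (uncut≤edges F A) eC ⟩
            edges A + edges C              ≤⟨ eD ⟩
            edges D ∎))
  where open ≤-Reasoning

-- Counting cut edges.

cutPairs : EdgeSet n → ℕ
cutPairs F = ∑₂ (inF F)

edgeCount≡half : (F : EdgeSet n) → edgeCount F ≡ ⌊ cutPairs F /2⌋
edgeCount≡half F = cong ⌊_/2⌋ (countB-allPairs (λ { (u , v) → inF F u v }))

twiceEdgesInduced≡edges : (X : VSet n) → twiceEdgesInduced X ≡ edges X
twiceEdgesInduced≡edges X = countB-allPairs (λ { (u , v) → X u ∧ X v ∧ adjFQ u v })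

size-complement : (X : VSet n) → size (not ∘ X) + size X ≡ 2 ^ n
size-complement {n} X = trans (size-─ (λ _ → true) X) (size-full {n})

-- Every ordered adjacent pair is either cut or uncut, and either inside C or incident
-- with its complement.
cutPairs-complement : 2 ≤ n → (F : EdgeSet n) (C : VSet n) → uncut F (λ _ → true) ≤ edges C →
  let s = size (not ∘ C) * (n + 1) in s + s ≤ cutPairs F + edges (not ∘ C)
cutPairs-complement {n} 2≤n F C le = +-cancelˡ-≤ (uncut F (λ _ → true)) _ _ (begin
  U + (s + s)                        ≡⟨ cong (U +_) (∑₂-incident 2≤n X) ⟨
  U + (I + edges X)                  ≡⟨ +-assoc U I (edges X) ⟨
  U + I + edges X                    ≤⟨ +-monoˡ-≤ (edges X) (+-monoˡ-≤ I le) ⟩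
  edges C + I + edges X              ≡⟨ cong (_+ edges X) total ⟩
  U + cutPairs F + edges X           ≡⟨ +-assoc U (cutPairs F) (edges X) ⟩
  U + (cutPairs F + edges X) ∎)
  where
  open ≤-Reasoning
  X = not ∘ C
  s = size X * (n + 1)
  U = uncut F (λ _ → true)
  I = ∑₂ (λ u v → adjFQ u v ∧ (X u ∨ X v))
  split : ∀ c c′ a f → ⟦ c ∧ c′ ∧ a ⟧ + ⟦ a ∧ (not c ∨ not c′) ⟧ ≡ ⟦ a ∧ not f ⟧ + ⟦ a ∧ f ⟧
  split false false false f     = refl
  split false false true  false = refl
  split false false true  true  = refl
  split false true  false f     = refl
  split false true  true  false = refl
  split false true  true  true  = refl
  split true  false false f     = refl
  split true  false true  false = refl
  split true  false true  true  = refl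
  split true  true  false f     = refl
  split true  true  true  false = refl
  split true  true  true  true  = refl
  total : edges C + I ≡ U + cutPairs F
  total = trans (sym (∑∑-+ (λ u v → ⟦ C u ∧ C v ∧ adjFQ u v ⟧) (λ u v → ⟦ adjFQ u v ∧ (X u ∨ X v) ⟧)))
         (trans (∑-cong (λ u → ∑-cong (λ v → split (C u) (C v) (adjFQ u v) (F u v ∨ F v u))))
                (∑∑-+ (λ u v → ⟦ adjDel F u v ⟧) (λ u v → ⟦ inF F u v ⟧)))

half-+ : ∀ m k → ⌊ m + (k + k) /2⌋ ≡ ⌊ m /2⌋ + k
half-+ m zero    = trans (cong ⌊_/2⌋ (+-identityʳ m)) (sym (+-identityʳ _))
half-+ m (suc k) = trans (cong ⌊_/2⌋ (shift m k)) (trans (cong suc (half-+ m k)) (sym (+-suc _ k)))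
  where
  shift : ∀ m k → m + (suc k + suc k) ≡ suc (suc (m + (k + k)))
  shift = solve-∀

-- The cut isolating a set.

elements : (g : ℕ) (X : VSet n) → size X ≡ g →
  Σ (Vec (V n) g) λ vs → (∀ i → X (lookup vs i) ≡ true) × (∀ i j → i ≢ j → lookup vs i ≢ lookup vs j)
elements zero    X _ = [] , (λ ()) , (λ ())
elements (suc g) X e
  with z , z∈ ← size⇒nonempty X (subst (1 ≤_) (sym e) (s≤s z≤n))
  with vs , vs∈ , distinct ← elements g (X ─ (z ==_)) (suc-injective (trans (sym (size-remove X z z∈)) e))
  = z ∷ vs
  , (λ { zero → z∈ ; (suc i) → proj₁ (∧-true (vs∈ i)) })
  , λ { zero    zero    ne → contradiction refl ne
      ; zero    (suc j) _  → fresh j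
      ; (suc i) zero    _  → fresh i ∘ sym
      ; (suc i) (suc j) ne → distinct i j (ne ∘ cong suc) }
  where
  fresh : ∀ i → z ≢ lookup vs i
  fresh i refl with ∧-true {X z} (vs∈ i)
  ... | _ , q = contradiction (trans (sym q) (cong not (==-refl z))) λ ()

-- Membership in an edge set symmetrises the function, so testing one end selects every edge
-- incident with `X`.
isolating : VSet n → EdgeSet n
isolating X u v = X u

isolating-adj : (X : VSet n) {u v : V n} → T (adjDel (isolating X) u v) → X u ≡ false × X v ≡ false
isolating-adj X {u} {v} t with adjFQ u v | X u | X v
... | true | false | false = refl , refl

isolating-Reach : (X : VSet n) {u v : V n} → Reach (isolating X) u v →
  u ≡ v ⊎ (X u ≡ false × X v ≡ false)
isolating-Reach X here = inj₁ refl
isolating-Reach X (step {u} {v} {w} a r) with p , q ← isolating-adj X {u} {v} a with isolating-Reach X r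
... | inj₁ refl    = inj₂ (p , q)
... | inj₂ (_ , s) = inj₂ (p , s)

isolating-cut : (g : ℕ) (X : VSet n) → size X ≡ g → g < 2 ^ n → IsKCompEdgeCut n (suc g) (isolating X)
isolating-cut g X e g<N
  with y , y∉ ← size<⇒missing X (subst (_< _) (sym e) g<N)
     | vs , vs∈ , distinct ← elements g X e
  -- The `g` isolated vertices and one vertex `y` outside `X` represent `suc g` components.
  = y ∷ vs , sep
  where
  sep : ∀ i j → i ≢ j → ¬ Reach (isolating X) (lookup (y ∷ vs) i) (lookup (y ∷ vs) j)
  sep zero    zero    ne r = ne refl
  sep zero    (suc j) ne r with isolating-Reach X r
  ... | inj₁ refl    = contradiction (trans (sym (vs∈ j)) y∉) λ ()
  ... | inj₂ (_ , q) = contradiction (trans (sym (vs∈ j)) q) λ ()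
  sep (suc i) j       ne r with isolating-Reach X r
  ... | inj₂ (p , _) = contradiction (trans (sym (vs∈ i)) p) λ ()
  sep (suc i) zero    ne r | inj₁ refl = contradiction (trans (sym (vs∈ i)) y∉) λ ()
  sep (suc i) (suc j) ne r | inj₁ p    = distinct i j (ne ∘ cong suc) p

-- Guarantees a vertex outside the optimal set: the exponent is the upper half of `n`, which is
-- below `n` from 2 on.
2^half<2^ : ∀ n → 2 ≤ n → 2 ^ ⌊ n + 1 /2⌋ < 2 ^ n
2^half<2^ n@(suc (suc m)) (s≤s (s≤s _)) =
  ^-monoʳ-< 2 (s≤s (s≤s z≤n)) (subst (λ k → ⌊ k /2⌋ < n) (+-comm 1 n) (⌈n/2⌉<n m))

isolating-edgeCount : 2 ≤ suc n → (X : VSet (suc n)) →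
  edgeCount (isolating X) ≡ (suc n + 1) * size X ∸ ⌊ edges X /2⌋
isolating-edgeCount {n} 2≤n X with k , e ← edges-even X = begin
  edgeCount (isolating X)                   ≡⟨ edgeCount≡half (isolating X) ⟩
  -- Adding `k` before subtracting it makes the truncated subtraction exact: by `total` the sum is
  -- the full degree sum over `X`.
  ⌊ c /2⌋                                   ≡⟨ m+n∸n≡m ⌊ c /2⌋ k ⟨
  ⌊ c /2⌋ + k ∸ k                           ≡⟨ cong₂ _∸_ total k≡ ⟩
  (suc n + 1) * size X ∸ ⌊ edges X /2⌋ ∎
  where
  open ≡-Reasoning
  c = cutPairs (isolating X)
  s = size X * (suc n + 1)
  k≡ : k ≡ ⌊ edges X /2⌋
  k≡ = trans (n≡⌊n+n/2⌋ k) (cong ⌊_/2⌋ (sym e))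
  total : ⌊ c /2⌋ + k ≡ (suc n + 1) * size X
  total = begin
    ⌊ c /2⌋ + k             ≡⟨ half-+ c k ⟨
    ⌊ c + (k + k) /2⌋       ≡⟨ cong (λ z → ⌊ c + z /2⌋) e ⟨
    ⌊ c + edges X /2⌋       ≡⟨ cong ⌊_/2⌋ (∑₂-incident 2≤n X) ⟩
    ⌊ s + s /2⌋             ≡⟨ n≡⌊n+n/2⌋ s ⟨
    s                       ≡⟨ *-comm (size X) (suc n + 1) ⟩
    (suc n + 1) * size X ∎

-- The lower bound and its attainment.

-- Here `ex` is half of the extremal number. Gathering all `suc g` parts leaves exactly `g` vertices
-- outside `C`, so the extremal bound applies to the complement of `C`.
edgeCount-lower : ∀ g ex → 2 ≤ suc n → (∀ (X : VSet (suc n)) → size X ≡ g → edges X ≤ ex + ex) →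
  (F : EdgeSet (suc n)) → IsKCompEdgeCut (suc n) (suc g) F → (suc n + 1) * g ∸ ex ≤ edgeCount F
edgeCount-lower {n} g ex 2≤n bound F (vs , sep) = decidable-stable (_ ≤? _) λ K →
  gather F g (λ _ → true) vs (λ _ _ _ → refl) (λ _ → refl) sep λ (C , sC , _ , eC) →
  let X = not ∘ C
      sX : size X ≡ g
      sX = +-cancelʳ-≡ (size C) (size X) g
        (trans (size-complement C) (trans (sym (size-full {suc n})) (trans (sym sC) (+-comm (size C) g))))
      d = size X * (suc n + 1)
  in K (m≤n+o⇒m∸n≤o _ ex (begin
    (suc n + 1) * g                ≡⟨ trans (*-comm (suc n + 1) g) (cong (_* (suc n + 1)) (sym sX)) ⟩
    d                              ≡⟨ n≡⌊n+n/2⌋ d ⟩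
    ⌊ d + d /2⌋                    ≤⟨ ⌊n/2⌋-mono (cutPairs-complement 2≤n F C eC) ⟩
    ⌊ cutPairs F + edges X /2⌋     ≤⟨ ⌊n/2⌋-mono (+-monoʳ-≤ (cutPairs F) (bound X sX)) ⟩
    ⌊ cutPairs F + (ex + ex) /2⌋   ≡⟨ half-+ (cutPairs F) ex ⟩
    ⌊ cutPairs F /2⌋ + ex          ≡⟨ +-comm _ ex ⟩
    ex + ⌊ cutPairs F /2⌋          ≡⟨ cong (ex +_) (edgeCount≡half F) ⟨
    ex + edgeCount F ∎))
  where open ≤-Reasoning

theorem12 : ∀ (n g : ℕ) → 5 ≤ n → 1 ≤ g → g ≤ 2 ^ ⌊ n + 1 /2⌋ →
    ∀ (ex : ℕ) → IsExG n g ex →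
    IsCλ n (suc g) ((n + 1) * g ∸ ⌊ ex /2⌋)
theorem12 n@(suc _) g 5≤n _ g≤ ex ((X , cX , eX) , max)
  -- From here on `g` is `size X` and the extremal number is `edges X` for the optimal `X`.
  with refl ← trans (sym (card≡size X)) cX
     | refl ← trans (sym (twiceEdgesInduced≡edges X)) eX
     | k , even ← edges-even X
  = (isolating X , isolating-cut (size X) X refl (≤-<-trans g≤ (2^half<2^ n 2≤n)) , isolating-edgeCount 2≤n X)
  , edgeCount-lower (size X) ⌊ edges X /2⌋ 2≤n bound
  where
  2≤n : 2 ≤ n
  2≤n = ≤-trans (s≤s (s≤s z≤n)) 5≤n
  -- Ordered pairs come in twos, so halving the extremal number loses nothing.
  halves : ⌊ edges X /2⌋ + ⌊ edges X /2⌋ ≡ edges X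
  halves rewrite even | sym (n≡⌊n+n/2⌋ k) = refl
  bound : (Y : VSet n) → size Y ≡ size X → edges Y ≤ ⌊ edges X /2⌋ + ⌊ edges X /2⌋
  bound Y sY = subst (edges Y ≤_) (sym halves)
    (subst (_≤ edges X) (twiceEdgesInduced≡edges Y) (max Y (trans (card≡size Y) sY)))
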